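{- The structures $\langle\mathcal P(\omega)/\mathrm{Fin},\sigma\rangle$ and $\langle\mathcal P(\omega)/\mathrm{Fin},\sigma^{ -1}\rangle$ are elementarily equivalent in the language of dynamical systems.
   Context: $\mathcal P(\omega)/\mathrm{Fin}$ is $\mathcal P(\omega)$ modulo finite sets, $\sigma([A])=[A+1]$ the shift. The language of dynamical systems is the first-order language with constants $\mathbf 0,\mathbf 1$, binary operations for join, meet and difference, the relation $\le$, and unary function symbols interpreted as an automorphism and its inverse. Elementarily equivalent means satisfying the same parameter-free first-order sentences. (No set-theoretic hypothesis beyond ZFC is assumed.) -}

module Defs where

open import Level using (0ℓ)
open import Data.Nat using (ℕ; zero; suc; _≤_)
open import Data.Bool using (Bool; true; false; _∧_; _∨_; not)
open import Data.Fin using (Fin)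
open import Data.Vec using (Vec; []; _∷_; lookup)
open import Data.Product using (Σ; _×_)
open import Data.Sum using (_⊎_)
open import Data.Empty using (⊥)
open import Relation.Binary.PropositionalEquality using (_≡_)
open import Function.Bundles using (_⇔_)

data Term (n : ℕ) : Set where
  var  : Fin n → Term n
  𝟎 𝟏  : Term n
  _⊔ₜ_ _⊓ₜ_ _∖ₜ_ : Term n → Term n → Term n
  fₜ f⁻¹ₜ : Term n → Term n

data Formula (n : ℕ) : Set where
  _≐_ _≼_ : Term n → Term n → Formula n
  ⊥ᶠ      : Formula n
  ¬ᶠ_     : Formula n → Formula n
  _∧ᶠ_ _∨ᶠ_ _⇒ᶠ_ : Formula n → Formula n → Formula n
  ∀ᶠ ∃ᶠ   : Formula (suc n) → Formula n

Sentence : Set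
Sentence = Formula 0

-- Structures for this language.  Equality symbol is interpreted by
-- the structure's equality relation _≈_ (a congruence in the intended
-- models; it is the quotient equality of P(ω)/Fin presented as a setoid).

record DynStructure : Set₁ where
  field
    Carrier : Set
    _≈_ _≤ₛ_ : Carrier → Carrier → Set
    zeroₛ oneₛ : Carrier
    joinₛ meetₛ diffₛ : Carrier → Carrier → Carrier
    autₛ autInvₛ : Carrier → Carrier

module _ (M : DynStructure) where
  open DynStructure M

  evalT : ∀ {n} → Vec Carrier n → Term n → Carrier
  evalT ρ (var i)   = lookup ρ i
  evalT ρ 𝟎         = zeroₛ
  evalT ρ 𝟏         = oneₛ
  evalT ρ (s ⊔ₜ t)  = joinₛ (evalT ρ s) (evalT ρ t)
  evalT ρ (s ⊓ₜ t)  = meetₛ (evalT ρ s) (evalT ρ t)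
  evalT ρ (s ∖ₜ t)  = diffₛ (evalT ρ s) (evalT ρ t)
  evalT ρ (fₜ t)    = autₛ (evalT ρ t)
  evalT ρ (f⁻¹ₜ t)  = autInvₛ (evalT ρ t)

  -- Tarskian satisfaction (read classically)
  Sat : ∀ {n} → Vec Carrier n → Formula n → Set
  Sat ρ (s ≐ t)   = evalT ρ s ≈ evalT ρ t
  Sat ρ (s ≼ t)   = evalT ρ s ≤ₛ evalT ρ t
  Sat ρ ⊥ᶠ        = ⊥
  Sat ρ (¬ᶠ φ)    = Sat ρ φ → ⊥
  Sat ρ (φ ∧ᶠ ψ)  = Sat ρ φ × Sat ρ ψ
  Sat ρ (φ ∨ᶠ ψ)  = Sat ρ φ ⊎ Sat ρ ψ
  Sat ρ (φ ⇒ᶠ ψ)  = Sat ρ φ → Sat ρ ψ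
  Sat ρ (∀ᶠ φ)    = (a : Carrier) → Sat (a ∷ ρ) φ
  Sat ρ (∃ᶠ φ)    = Σ Carrier (λ a → Sat (a ∷ ρ) φ)

  _⊨_ : Sentence → Set
  _⊨_ = Sat []

ElemEquiv : DynStructure → DynStructure → Set
ElemEquiv M N = (φ : Sentence) → (_⊨_ M φ) ⇔ (_⊨_ N φ)

-- P(ω) as characteristic functions ℕ → Bool; P(ω)/Fin as the setoid
-- quotient by "symmetric difference is finite" (= eventually equal).

Pω : Set
Pω = ℕ → Bool

-- [A] = [B] in P(ω)/Fin  iff  A △ B finite
_=*_ : Pω → Pω → Set
A =* B = Σ ℕ (λ N → (n : ℕ) → N ≤ n → A n ≡ B n)

-- [A] ≤ [B]  iff  A ∖ B finite
_⊆*_ : Pω → Pω → Set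
A ⊆* B = Σ ℕ (λ N → (n : ℕ) → N ≤ n → A n ≡ true → B n ≡ true)

∅ω ωω : Pω
∅ω _ = false
ωω _ = true

_∪ω_ _∩ω_ _∖ω_ : Pω → Pω → Pω
(A ∪ω B) n = A n ∨ B n
(A ∩ω B) n = A n ∧ B n
(A ∖ω B) n = A n ∧ not (B n)

shift : Pω → Pω
shift A zero    = false
shift A (suc n) = A n

-- its inverse on P(ω)/Fin: A ↦ (A - 1) ∩ ω = { n : n + 1 ∈ A }
unshift : Pω → Pω
unshift A n = A (suc n)

PωFin-σ : DynStructure
PωFin-σ = record
  { Carrier = Pω ; _≈_ = _=*_ ; _≤ₛ_ = _⊆*_
  ; zeroₛ = ∅ω ; oneₛ = ωω
  ; joinₛ = _∪ω_ ; meetₛ = _∩ω_ ; diffₛ = _∖ω_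
  ; autₛ = shift ; autInvₛ = unshift }

PωFin-σ⁻¹ : DynStructure
PωFin-σ⁻¹ = record
  { Carrier = Pω ; _≈_ = _=*_ ; _≤ₛ_ = _⊆*_
  ; zeroₛ = ∅ω ; oneₛ = ωω
  ; joinₛ = _∪ω_ ; meetₛ = _∩ω_ ; diffₛ = _∖ω_
  ; autₛ = unshift ; autInvₛ = shift }

{-# OPTIONS --safe #-}

-- Read a tuple of n subsets of ω as an ω-word over the letters Vec Bool n, and
-- compare finite words by Ehrenfeucht–Fraïssé games of finite rank in which a
-- move adds one more bit to every letter.  The rank k equivalence of finite
-- words is a congruence of finite index, and it is respected by reversal.
-- Two ω-words are rank k equivalent "up to orientation" when they can be cut
-- into blocks such that every union of consecutive blocks of the one is
-- equivalent to the reversal of every union of consecutive blocks of the other.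
-- If a further set is added to the first word, Ramsey's theorem provides a
-- coarser cutting into blocks of one single idempotent class of rank k - 1, and
-- answering inside each block of the second word restores the equivalence.
-- Atomic formulas only depend on which pairs of adjacent letters occur
-- infinitely often, and reversal of the blocks exchanges shift and unshift.

module Submission where

open import Defs
open import Level using (0ℓ)
open import Axiom.ExcludedMiddle using (ExcludedMiddle)
open import Data.Bool using (Bool; true; false; _∧_; _∨_; not; if_then_else_)
open import Data.Fin using (Fin; zero; suc; combine; funToFin; punchOut; finToFun)
open import Data.Fin.Properties using (combine-injective; finToFun-funToFin; punchIn-punchOut; suc-injective)
open import Data.List using (List; []; _∷_; _++_; [_]; head; map; reverse; length)
open import Data.List.Properties
  using (∷-injective; ++-assoc; map-++; map-∘; map-cong; reverse-++; unfold-reverse;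
         reverse-involutive; reverse-map; length-reverse)
open import Data.Maybe using (Maybe; just; nothing; _<∣>_)
open import Data.Nat
open import Data.Nat.Properties hiding (suc-injective)
open import Data.Product using (Σ; ∃; ∃-syntax; _×_; _,_; proj₁; proj₂; swap)
open import Data.Sum using (_⊎_; inj₁; inj₂)
open import Data.Vec as Vec using (Vec; []; _∷_; lookup; tail)
open import Data.Vec.Properties using (lookup-map)
open import Function using (_∘_; id)
open import Function.Bundles using (mk⇔)
open import Relation.Binary.Definitions using (tri<; tri≈; tri>)
open import Relation.Binary.PropositionalEquality
  using (_≡_; _≢_; refl; sym; trans; cong; cong₂; subst; subst₂)
open import Relation.Nullary using (Dec; yes; no; does; contradiction)
open import Relation.Nullary.Decidable using (dec-true; dec-false)

private variable
  A X : Set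
  k m n : ℕ

-- Finite words

Word : ℕ → Set
Word n = List (Vec Bool n)

data Adjacent {A : Set} (a b : A) : List A → Set where
  here  : ∀ {u} → Adjacent a b (a ∷ b ∷ u)
  there : ∀ {c u} → Adjacent a b u → Adjacent a b (c ∷ u)

Adjacent-++ˡ : ∀ {a b : A} {u} v → Adjacent a b u → Adjacent a b (u ++ v)
Adjacent-++ˡ v here      = here
Adjacent-++ˡ v (there p) = there (Adjacent-++ˡ v p)

Adjacent-++ʳ : ∀ {a b : A} u {v} → Adjacent a b v → Adjacent a b (u ++ v)
Adjacent-++ʳ []      p = p
Adjacent-++ʳ (c ∷ u) p = there (Adjacent-++ʳ u p)

Adjacent-reverse : ∀ {a b : A} {u} → Adjacent a b u → Adjacent b a (reverse u)
Adjacent-reverse {a = a} {b} {_ ∷ _ ∷ u} here =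
  subst (Adjacent b a) (sym eq) (Adjacent-++ʳ (reverse u) here)
  where
  eq : reverse (a ∷ b ∷ u) ≡ reverse u ++ b ∷ a ∷ []
  eq = trans (unfold-reverse a (b ∷ u))
      (trans (cong (_++ [ a ]) (unfold-reverse b u)) (++-assoc (reverse u) [ b ] [ a ]))
Adjacent-reverse {a = a} {b} {c ∷ u} (there p) =
  subst (Adjacent b a) (sym (unfold-reverse c u)) (Adjacent-++ˡ [ c ] (Adjacent-reverse p))

Adjacent-map : ∀ {B : Set} (g : A → B) {a b u} → Adjacent a b u → Adjacent (g a) (g b) (map g u)
Adjacent-map g here      = here
Adjacent-map g (there p) = there (Adjacent-map g p)

Adjacent-map⁻ : ∀ {B : Set} (g : A → B) {a b} u → Adjacent a b (map g u) →
                ∃[ x ] ∃[ y ] g x ≡ a × g y ≡ b × Adjacent x y u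
Adjacent-map⁻ g (x ∷ y ∷ u) here = x , y , refl , refl , here
Adjacent-map⁻ g (c ∷ u) (there p) =
  let x , y , e , f , q = Adjacent-map⁻ g u p in x , y , e , f , there q

head-++ : (u v : List A) → head (u ++ v) ≡ (head u <∣> head v)
head-++ []      v = refl
head-++ (a ∷ u) v = refl

head-reverse-++ : (u v : List A) → head (reverse (u ++ v)) ≡ (head (reverse v) <∣> head (reverse u))
head-reverse-++ u v = trans (cong head (reverse-++ u v)) (head-++ (reverse v) (reverse u))

head≡just : ∀ (u : List A) {a} → head u ≡ just a → ∃[ v ] u ≡ a ∷ v
head≡just (a ∷ u) refl = u , refl

Adjacent-join : ∀ {a b : A} u v → head (reverse u) ≡ just a → head v ≡ just b → Adjacent a b (u ++ v)
Adjacent-join {a = a} {b} u v p q with head≡just (reverse u) p | head≡just v q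
... | r , e | s , refl = subst (Adjacent a b) (sym eq) (Adjacent-++ʳ (reverse r) here)
  where
  eq : u ++ b ∷ s ≡ reverse r ++ a ∷ b ∷ s
  eq = trans (cong (_++ b ∷ s) (trans (sym (reverse-involutive u))
         (trans (cong reverse e) (unfold-reverse a r)))) (++-assoc (reverse r) [ a ] (b ∷ s))

Adjacent-split : ∀ {a b : A} u {v} → Adjacent a b (u ++ v) →
  Adjacent a b u ⊎ (head (reverse u) ≡ just a × head v ≡ just b) ⊎ Adjacent a b v
Adjacent-split []          p         = inj₂ (inj₂ p)
Adjacent-split (c ∷ [])    here      = inj₂ (inj₁ (refl , refl))
Adjacent-split (c ∷ [])    (there p) = inj₂ (inj₂ p)
Adjacent-split (c ∷ d ∷ u) here      = inj₁ here
Adjacent-split (c ∷ d ∷ u) (there p) with Adjacent-split (d ∷ u) p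
... | inj₁ q = inj₁ (there q)
... | inj₂ (inj₂ q) = inj₂ (inj₂ q)
... | inj₂ (inj₁ (q , r)) =
  inj₂ (inj₁ (trans (head-reverse-++ [ c ] (d ∷ u)) (cong (_<∣> just c) q) , r))

map≡++ : ∀ {B : Set} (g : A → B) (x : List A) u {v} → map g x ≡ u ++ v →
         ∃[ y ] ∃[ z ] x ≡ y ++ z × map g y ≡ u × map g z ≡ v
map≡++ g x       []      e = [] , x , refl , refl , e
map≡++ g (a ∷ x) (b ∷ u) e =
  let e₁ , e₂ = ∷-injective e
      y , z , r , p , q = map≡++ g x u e₂
  in a ∷ y , z , cong (a ∷_) r , cong₂ _∷_ e₁ p , q

-- Equivalence of finite words in games of finite rank

-- Adjacent pairs are what the atomic formulas will need. The first and last letters are kept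
-- because concatenation creates one new pair, from the end of the left word and the start of the
-- right one.
record Base {A : Set} (u v : List A) : Set where
  field
    heads    : head u ≡ head v
    lasts    : head (reverse u) ≡ head (reverse v)
    adjacent : ∀ {a b} → Adjacent a b u → Adjacent a b v
open Base

infix 4 _≲[_]_ _≋[_]_

mutual
  -- This is the game of monadic second-order logic: a move is a set of positions, stored as a new
  -- first bit of each letter, and `map tail` erases it. The answer is compared by `≋`, so the next
  -- move may be made in either word.
  _≲[_]_ : Word n → ℕ → Word n → Set
  u ≲[ zero ]  v = Base u v
  u ≲[ suc k ] v = ∀ x → map tail x ≡ u → ∃[ y ] map tail y ≡ v × x ≋[ k ] y

  _≋[_]_ : Word n → ℕ → Word n → Set
  u ≋[ k ] v = u ≲[ k ] v × v ≲[ k ] u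

≲-refl : ∀ k {u : Word n} → u ≲[ k ] u
≲-refl zero    = record { heads = refl ; lasts = refl ; adjacent = id }
≲-refl (suc k) x e = x , e , ≲-refl k , ≲-refl k

≋-refl : ∀ k {u : Word n} → u ≋[ k ] u
≋-refl k = ≲-refl k , ≲-refl k

≡⇒≋ : ∀ k {u v : Word n} → u ≡ v → u ≋[ k ] v
≡⇒≋ k refl = ≋-refl k

mutual
  ≲-trans : ∀ k {u v w : Word n} → u ≲[ k ] v → v ≲[ k ] w → u ≲[ k ] w
  ≲-trans zero p q = record
    { heads    = trans (heads p) (heads q)
    ; lasts    = trans (lasts p) (lasts q)
    ; adjacent = adjacent q ∘ adjacent p }
  ≲-trans (suc k) p q x e =
    let y , f , r = p x e
        z , g , s = q y f
    in z , g , ≋-trans k r s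

  ≋-trans : ∀ k {u v w : Word n} → u ≋[ k ] v → v ≋[ k ] w → u ≋[ k ] w
  ≋-trans k (p , p′) (q , q′) = ≲-trans k p q , ≲-trans k q′ p′

mutual
  -- A move on a concatenation splits into a move on each factor, and the two answers are joined.
  ≲-++ : ∀ k {u u′ v v′ : Word n} → u ≲[ k ] u′ → v ≲[ k ] v′ → u ++ v ≲[ k ] u′ ++ v′
  ≲-++ zero {u} {u′} {v} {v′} p q = record
    { heads    = trans (head-++ u v) (trans (cong₂ _<∣>_ (heads p) (heads q)) (sym (head-++ u′ v′)))
    ; lasts    = trans (head-reverse-++ u v)
                (trans (cong₂ _<∣>_ (lasts q) (lasts p)) (sym (head-reverse-++ u′ v′)))
    ; adjacent = λ r → join (Adjacent-split u r) }
    where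
    join : ∀ {a b} → Adjacent a b u ⊎ (head (reverse u) ≡ just a × head v ≡ just b) ⊎ Adjacent a b v →
           Adjacent a b (u′ ++ v′)
    join (inj₁ r) = Adjacent-++ˡ v′ (adjacent p r)
    join (inj₂ (inj₁ (r , s))) =
      Adjacent-join u′ v′ (trans (sym (lasts p)) r) (trans (sym (heads q)) s)
    join (inj₂ (inj₂ r)) = Adjacent-++ʳ u′ (adjacent q r)
  ≲-++ (suc k) {u} p q x e with map≡++ tail x u e
  ... | y , z , refl , f , g =
    let y′ , f′ , r = p y f
        z′ , g′ , s = q z g
    in y′ ++ z′ , trans (map-++ tail y′ z′) (cong₂ _++_ f′ g′) , ≋-++ k r s

  ≋-++ : ∀ k {u u′ v v′ : Word n} → u ≋[ k ] u′ → v ≋[ k ] v′ → u ++ v ≋[ k ] u′ ++ v′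
  ≋-++ k (p , p′) (q , q′) = ≲-++ k p q , ≲-++ k p′ q′

mutual
  ≲-reverse : ∀ k {u v : Word n} → u ≲[ k ] v → reverse u ≲[ k ] reverse v
  ≲-reverse zero {u} {v} p = record
    { heads    = lasts p
    ; lasts    = trans (cong head (reverse-involutive u))
                (trans (heads p) (cong head (sym (reverse-involutive v))))
    ; adjacent = λ {a} {b} r → Adjacent-reverse (adjacent p
        (subst (Adjacent b a) (reverse-involutive u) (Adjacent-reverse r))) }
  ≲-reverse (suc k) {u} p x e =
    let y , f , r = p (reverse x) (trans (reverse-map tail x)
                      (trans (cong reverse e) (reverse-involutive u)))
    in reverse y , trans (reverse-map tail y) (cong reverse f) ,
       subst (_≋[ k ] reverse y) (reverse-involutive x) (≋-reverse k r)

  ≋-reverse : ∀ k {u v : Word n} → u ≋[ k ] v → reverse u ≋[ k ] reverse v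
  ≋-reverse k (p , q) = ≲-reverse k p , ≲-reverse k q

keepBit : (Vec Bool m → Vec Bool n) → Vec Bool (suc m) → Vec Bool (suc n)
keepBit g (b ∷ a) = b ∷ g a

lift-map : (g : Vec Bool m → Vec Bool n) (x : Word (suc n)) (u : Word m) → map tail x ≡ map g u →
           ∃[ y ] map tail y ≡ u × map (keepBit g) y ≡ x
lift-map g []             []      e = [] , refl , refl
lift-map g ((b ∷ ._) ∷ x) (a ∷ u) e with ∷-injective e
... | refl , e′ =
  let y , p , q = lift-map g x u e′ in (b ∷ a) ∷ y , cong (a ∷_) p , cong ((b ∷ g a) ∷_) q

map-tail-keepBit : (g : Vec Bool m → Vec Bool n) (x : Word (suc m)) →
                   map tail (map (keepBit g) x) ≡ map g (map tail x)
map-tail-keepBit g x = trans (sym (map-∘ x)) (trans (map-cong (λ { (b ∷ a) → refl }) x) (map-∘ x))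

head-map-cong : ∀ {B : Set} (g : A → B) u v → head u ≡ head v → head (map g u) ≡ head (map g v)
head-map-cong g []      []       e    = refl
head-map-cong g (a ∷ u) (._ ∷ v) refl = refl

mutual
  -- A letter map does not touch the bits added by moves, so a move over `map g u` lifts to one over
  -- `u`.
  ≲-map : ∀ k (g : Vec Bool m → Vec Bool n) {u v} → u ≲[ k ] v → map g u ≲[ k ] map g v
  ≲-map zero g {u} {v} p = record
    { heads    = head-map-cong g u v (heads p)
    ; lasts    = trans (cong head (sym (reverse-map g u)))
                (trans (head-map-cong g (reverse u) (reverse v) (lasts p))
                       (cong head (reverse-map g v)))
    ; adjacent = λ r → adj (Adjacent-map⁻ g u r) }
    where
    adj : ∀ {a b} → (∃[ x ] ∃[ y ] g x ≡ a × g y ≡ b × Adjacent x y u) → Adjacent a b (map g v)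
    adj (x , y , refl , refl , r) = Adjacent-map g (adjacent p r)
  ≲-map (suc k) g {u} p x e =
    let y , f , q = lift-map g x u e
        z , h , r = p y f
    in map (keepBit g) z , trans (map-tail-keepBit g z) (cong (map g) h) ,
       subst (_≋[ k ] map (keepBit g) z) q (≋-map k (keepBit g) r)

  ≋-map : ∀ k (g : Vec Bool m → Vec Bool n) {u v} → u ≋[ k ] v → map g u ≋[ k ] map g v
  ≋-map k g (p , q) = ≲-map k g p , ≲-map k g q

map-tail-pad : (u : Word n) → map tail (map (false ∷_) u) ≡ u
map-tail-pad []      = refl
map-tail-pad (a ∷ u) = cong (a ∷_) (map-tail-pad u)

-- One round is spent on the empty set; mapping by `tail` then erases its bit from both words.
≋-pred : ∀ k {u v : Word n} → u ≋[ suc k ] v → u ≋[ k ] v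
≋-pred k {u} (p , _) with p (map (false ∷_) u) (map-tail-pad u)
... | y , refl , r = subst (_≋[ k ] map tail y) (map-tail-pad u) (≋-map k tail r)

-- Equivalences of finite index and Ramsey's theorem

-- A finite colouring whose fibres refine the relation: several colours may share a class, so only a
-- bound on the index is recorded.
FiniteIndex : (X → X → Set) → Set
FiniteIndex {X} _~_ = ∃[ N ] Σ (X → Fin N) λ c → ∀ {u v} → c u ≡ c v → u ~ v

finiteIndex-× : ∀ {E F : X → X → Set} → FiniteIndex E → FiniteIndex F →
                FiniteIndex (λ u v → E u v × F u v)
finiteIndex-× (_ , c , p) (_ , d , q) = _ , (λ u → combine (c u) (d u)) , λ {u} {v} e →
  let e₁ , e₂ = combine-injective (c u) (d u) (c v) (d v) e in p e₁ , q e₂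

finiteIndex-sym : ∀ {E : X → X → Set} → FiniteIndex E → FiniteIndex (λ u v → E u v × E v u)
finiteIndex-sym (_ , c , p) = _ , c , λ e → p e , p (sym e)

bit : Bool → Fin 2
bit true  = suc zero
bit false = zero

bit-injective : ∀ x y → bit x ≡ bit y → x ≡ y
bit-injective true  true  e = refl
bit-injective false false e = refl

code : Vec Bool n → Fin (2 ^ n)
code []      = zero
code (b ∷ a) = combine (bit b) (code a)

code-injective : {a b : Vec Bool n} → code a ≡ code b → a ≡ b
code-injective {a = []}    {[]}    e = refl
code-injective {a = x ∷ a} {y ∷ b} e =
  let e₁ , e₂ = combine-injective (bit x) (code a) (bit y) (code b) e
  in cong₂ _∷_ (bit-injective x y e₁) (code-injective e₂)

codeMaybe : Maybe (Vec Bool n) → Fin (suc (2 ^ n))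
codeMaybe nothing  = zero
codeMaybe (just a) = suc (code a)

codeMaybe-injective : (a b : Maybe (Vec Bool n)) → codeMaybe a ≡ codeMaybe b → a ≡ b
codeMaybe-injective nothing  nothing  e = refl
codeMaybe-injective (just a) (just b) e = cong just (code-injective (suc-injective e))

finiteIndex-Maybe : (f : X → Maybe (Vec Bool n)) → FiniteIndex (λ u v → f u ≡ f v)
finiteIndex-Maybe f = _ , codeMaybe ∘ f , codeMaybe-injective _ _

StrictMono : (ℕ → ℕ) → Set
StrictMono h = ∀ {a b} → a < b → h a < h b

strictMono : {h : ℕ → ℕ} → (∀ n → h n < h (suc n)) → StrictMono h
strictMono step {a} {suc b} (s≤s a≤b) with m≤n⇒m<n∨m≡n a≤b
... | inj₁ a<b  = <-trans (strictMono step a<b) (step b)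
... | inj₂ refl = step b

n≤h[n] : {h : ℕ → ℕ} → StrictMono h → ∀ n → n ≤ h n
n≤h[n] mono zero    = z≤n
n≤h[n] mono (suc n) = ≤-<-trans (n≤h[n] mono n) (mono (n<1+n n))

strictMono⇒mono : {h : ℕ → ℕ} → StrictMono h → ∀ {a b} → a ≤ b → h a ≤ h b
strictMono⇒mono mono a≤b with m≤n⇒m<n∨m≡n a≤b
... | inj₁ a<b  = <⇒≤ (mono a<b)
... | inj₂ refl = ≤-refl

enumerate : (P : ℕ → Set) → (∀ n → ∃[ m ] n < m × P m) → ∃[ h ] StrictMono h × ∀ n → P (h n)
enumerate P inf = h , strictMono (λ n → proj₁ (proj₂ (inf (h n)))) , holds
  where
  h : ℕ → ℕ
  h zero    = proj₁ (inf 0)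
  h (suc n) = proj₁ (inf (h n))

  holds : ∀ n → P (h n)
  holds zero    = proj₂ (proj₂ (inf 0))
  holds (suc n) = proj₂ (proj₂ (inf (h n)))

module _ (em : ExcludedMiddle 0ℓ) where

  -- Excluded middle turns the truth values of the predicates into a function from `Fin N` to
  -- `Fin 2`, which `funToFin` codes as a colour.
  finiteIndex-∀ : ∀ {N} (P : Fin N → X → Set) → FiniteIndex (λ u v → ∀ q → P q u → P q v)
  finiteIndex-∀ {X} P = _ , funToFin ∘ truth , λ {u} {v} e q →
    transfer em em (trans (sym (finToFun-funToFin (truth u) q))
      (trans (cong (λ f → finToFun f q) e) (finToFun-funToFin (truth v) q)))
    where
    truth : X → _ → Fin 2
    truth u q = bit (does (em {P q u}))

    transfer : ∀ {P Q : Set} (d : Dec P) (d′ : Dec Q) → bit (does d) ≡ bit (does d′) → P → Q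
    transfer _        (yes q) e p = q
    transfer (no ¬p)  (no _)  e p = contradiction p ¬p

  -- At rank zero there are finitely many letters and pairs of letters. At rank `suc k` a word is
  -- classified by the set of rank `k` colours that its markings by one more bit attain.
  finiteIndex-≋ : ∀ k → FiniteIndex (λ (u v : Word n) → u ≋[ k ] v)
  finiteIndex-≋ {n} zero =
    let N , c , p = finiteIndex-sym (finiteIndex-× (finiteIndex-Maybe head)
                     (finiteIndex-× (finiteIndex-Maybe (head ∘ reverse)) (finiteIndex-∀ Pair)))
    in N , c , λ e → let r , s = p e in base r , base s
    where
    Pair : Fin (2 ^ n * 2 ^ n) → Word n → Set
    Pair q u = ∃[ a ] ∃[ b ] combine (code a) (code b) ≡ q × Adjacent a b u

    base : {u v : Word n} → head u ≡ head v × head (reverse u) ≡ head (reverse v) ×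
           (∀ q → Pair q u → Pair q v) → Base u v
    base {u} {v} (p , q , r) = record
      { heads = p ; lasts = q ; adjacent = λ s → adj (r _ (_ , _ , refl , s)) }
      where
      adj : ∀ {a b} → Pair (combine (code a) (code b)) v → Adjacent a b v
      adj {a} {b} (a′ , b′ , e , s) =
        let e₁ , e₂ = combine-injective (code a′) (code b′) (code a) (code b) e
        in subst₂ (λ x y → Adjacent x y v) (code-injective e₁) (code-injective e₂) s
  finiteIndex-≋ (suc k) =
    let N , c , p = finiteIndex-≋ k
        N′ , c′ , p′ = finiteIndex-∀ λ q u → ∃[ x ] map tail x ≡ u × c x ≡ q
        sim : ∀ {u v} → c′ u ≡ c′ v → u ≲[ suc k ] v
        sim e x f = let y , g , h = p′ e (c x) (x , f , refl) in y , g , p (sym h)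
    in N′ , c′ , λ e → sim e , sim (sym e)

  -- Induction on the number of colours: either `zero` disappears after some `n` and the tail is
  -- recoloured without it, or it recurs forever and its occurrences are enumerated.
  pigeonhole : ∀ {N} (c : ℕ → Fin N) → ∃[ h ] StrictMono h × ∃[ q ] ∀ n → c (h n) ≡ q
  pigeonhole {zero} c with () ← c 0
  pigeonhole {suc N} c with em {∃[ n ] ∀ m → n < m → zero ≢ c m}
  ... | yes (n , avoid) =
    let h , mono , q , e = pigeonhole (λ m → punchOut (avoid (suc n + m) (m≤m+n (suc n) m)))
    in (λ m → suc n + h m) , (λ a<b → +-monoʳ-< (suc n) (mono a<b)) , suc q ,
       λ m → trans (sym (punchIn-punchOut (avoid (suc n + h m) (m≤m+n (suc n) (h m))))) (cong suc (e m))
  ... | no ¬avoid =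
    let h , mono , e = enumerate (λ m → c m ≡ zero) inf in h , mono , zero , e
    where
    inf : ∀ n → ∃[ m ] n < m × c m ≡ zero
    inf n with em {∃[ m ] n < m × c m ≡ zero}
    ... | yes p = p
    ... | no ¬p = contradiction (n , λ m n<m e → ¬p (m , n<m , sym e)) ¬avoid

  -- The first term of a stage has one colour with all terms of the next stage. Along these first
  -- terms the colour of a pair thus depends on its smaller member alone, and the pigeonhole
  -- principle makes it constant.
  ramsey : ∀ {N} (c : ℕ → ℕ → Fin N) →
           ∃[ h ] StrictMono h × ∃[ q ] ∀ {a b} → a < b → c (h a) (h b) ≡ q
  ramsey {N} c =
    let h , h-mono , q , e = pigeonhole colour
    in first ∘ h , (λ a<b → first-mono (h-mono a<b)) , q ,
       λ {a} a<b → trans (first-colour (h-mono a<b)) (e a)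
    where
    Stage : Set
    Stage = ∃ StrictMono

    homogenise : (s : Stage) → ∃[ h ] StrictMono h ×
                 ∃[ q ] ∀ n → c (proj₁ s 0) (proj₁ s (suc (h n))) ≡ q
    homogenise (g , _) = pigeonhole (λ n → c (g 0) (g (suc n)))

    stage : ℕ → Stage
    stage zero    = id , id
    stage (suc n) = let g , g-mono = stage n
                        h , h-mono , _ = homogenise (stage n)
                    in g ∘ suc ∘ h , g-mono ∘ s≤s ∘ h-mono

    first : ℕ → ℕ
    first n = proj₁ (stage n) 0

    colour : ℕ → Fin N
    colour n = proj₁ (proj₂ (proj₂ (homogenise (stage n))))

    later : ∀ {a b} → a ≤ b → ∀ t → ∃[ s ] proj₁ (stage b) t ≡ proj₁ (stage a) s
    later {a} {b} a≤b t with m≤n⇒m<n∨m≡n a≤b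
    later _ t | inj₂ refl = t , refl
    later {b = suc b} _ t | inj₁ (s≤s a≤b) = later a≤b _

    first-mono : StrictMono first
    -- `a < b` unfolds to `suc a ≤ b`, so `first b` occurs in stage `suc a`, which omits the first
    -- term of stage `a`.
    first-mono {a} a<b with later a<b 0
    ... | s , e = subst (first a <_) (sym e) (proj₂ (stage a) z<s)

    first-colour : ∀ {a b} → a < b → c (first a) (first b) ≡ colour a
    first-colour {a} a<b with later a<b 0
    ... | s , e = trans (cong (c (first a)) e) (proj₂ (proj₂ (proj₂ (homogenise (stage a)))) s)

  ramsey-~ : {_~_ : X → X → Set} → FiniteIndex _~_ → (f : ℕ → ℕ → X) →
             ∃[ h ] StrictMono h × ∀ {a b c d} → a < b → c < d → f (h a) (h b) ~ f (h c) (h d)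
  ramsey-~ (_ , colour , p) f =
    let h , mono , _ , e = ramsey (λ a b → colour (f a b))
    in h , mono , λ a<b c<d → p (trans (e a<b) (sym (e c<d)))

-- Blocks of ω-words

ωWord : ℕ → Set
ωWord n = ℕ → Vec Bool n

infixr 5 _⊹_

_⊹_ : Pω → ωWord n → ωWord (suc n)
(B ⊹ w) i = B i ∷ w i

factor : (ℕ → A) → ℕ → ℕ → List A
factor w a zero    = []
factor w a (suc l) = w a ∷ factor w (suc a) l

factor-cong : {w x : ℕ → A} → ∀ a l →
              (∀ i → a ≤ i → i < a + l → w i ≡ x i) → factor w a l ≡ factor x a l
factor-cong a zero    e = refl
factor-cong a (suc l) e =
  cong₂ _∷_ (e a ≤-refl (m<m+n a z<s))
    (factor-cong (suc a) l λ i a<i i<b → e i (<⇒≤ a<i) (subst (i <_) (sym (+-suc a l)) i<b))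

factor-map : ∀ {B : Set} (g : A → B) (w : ℕ → A) a l → factor (g ∘ w) a l ≡ map g (factor w a l)
factor-map g w a zero    = refl
factor-map g w a (suc l) = cong (g (w a) ∷_) (factor-map g w (suc a) l)

factor-+ : (w : ℕ → A) → ∀ a l m → factor w a (l + m) ≡ factor w a l ++ factor w (a + l) m
factor-+ w a zero    m = cong (λ b → factor w b m) (sym (+-identityʳ a))
factor-+ w a (suc l) m = cong (w a ∷_)
  (trans (factor-+ w (suc a) l m) (cong (λ b → factor w (suc a) l ++ factor w b m) (sym (+-suc a l))))

Adjacent-factor : (w : ℕ → A) → ∀ a l i → a ≤ i → suc i < a + l →
                  Adjacent (w i) (w (suc i)) (factor w a l)
Adjacent-factor w a zero i a≤i i<b =
  contradiction (≤-<-trans a≤i (<-trans (n<1+n i) i<b)) (<-irrefl (sym (+-identityʳ a)))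
Adjacent-factor w a (suc l) i a≤i i<b with m≤n⇒m<n∨m≡n a≤i
... | inj₁ a<i = there (Adjacent-factor w (suc a) l i a<i (subst (suc i <_) (+-suc a l) i<b))
Adjacent-factor w a (suc zero)    .a _ i<b | inj₂ refl = contradiction i<b (<-irrefl (+-comm 1 a))
Adjacent-factor w a (suc (suc l)) .a _ i<b | inj₂ refl = here

Adjacent-factor⁻ : ∀ {x y : A} (w : ℕ → A) a l → Adjacent x y (factor w a l) →
                   ∃[ i ] a ≤ i × w i ≡ x × w (suc i) ≡ y
Adjacent-factor⁻ w a (suc (suc l)) here      = a , ≤-refl , refl , refl
Adjacent-factor⁻ w a (suc l)       (there p) =
  let i , a<i , e , f = Adjacent-factor⁻ w (suc a) l p in i , <⇒≤ a<i , e , f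

-- The letters at positions a ≤ i < b; truncated subtraction makes it empty when b ≤ a.
block : (ℕ → A) → ℕ → ℕ → List A
block w a b = factor w a (b ∸ a)

block-cong : {w x : ℕ → A} → ∀ {a b} → a ≤ b →
             (∀ i → a ≤ i → i < b → w i ≡ x i) → block w a b ≡ block x a b
block-cong {a = a} {b} a≤b e =
  factor-cong a (b ∸ a) λ i a≤i i<b → e i a≤i (subst (i <_) (m+[n∸m]≡n a≤b) i<b)

block-map : ∀ {B : Set} (g : A → B) (w : ℕ → A) a b → block (g ∘ w) a b ≡ map g (block w a b)
block-map g w a b = factor-map g w a (b ∸ a)

block-++ : (w : ℕ → A) → ∀ {a b c} → a ≤ b → b ≤ c → block w a c ≡ block w a b ++ block w b c
block-++ w {a} {b} {c} a≤b b≤c =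
  trans (cong (factor w a) lengths)
 (trans (factor-+ w a (b ∸ a) (c ∸ b))
        (cong (λ d → block w a b ++ factor w d (c ∸ b)) (m+[n∸m]≡n a≤b)))
  where
  lengths : c ∸ a ≡ (b ∸ a) + (c ∸ b)
  lengths = trans (cong (_∸ a) (sym (m+[n∸m]≡n b≤c))) (+-∸-comm (c ∸ b) a≤b)

Adjacent-block : (w : ℕ → A) → ∀ {a b i} → a ≤ i → suc i < b → Adjacent (w i) (w (suc i)) (block w a b)
Adjacent-block w {a} {b} {i} a≤i i<b = Adjacent-factor w a (b ∸ a) i a≤i
  (subst (suc i <_) (sym (m+[n∸m]≡n (≤-trans a≤i (<⇒≤ (<-trans (n<1+n i) i<b))))) i<b)

override : (β : Pω) (a : ℕ) (b : Bool) → ∃[ β′ ] β′ a ≡ b × ∀ i → a < i → β i ≡ β′ i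
override β a b = (λ i → if does (i ≟ a) then b else β i) ,
  cong (if_then b else β a) (dec-true (a ≟ a) refl) ,
  λ i a<i → cong (if_then b else β i) (sym (dec-false (i ≟ a) (>⇒≢ a<i)))

-- An answer in the game is a finite word; this turns its bits into a subset of ω. The set is built
-- from the right end, so `override` changes no position already settled.
factor-lift : (w : ωWord n) → ∀ a l (v : Word (suc n)) →
              map tail v ≡ factor w a l → ∃[ β ] v ≡ factor (β ⊹ w) a l
factor-lift w a zero    []            e = ∅ω , refl
factor-lift w a (suc l) ((b ∷ x) ∷ v) e =
  let e₁ , e₂ = ∷-injective e
      β , p = factor-lift w (suc a) l v e₂
      β′ , q , r = override β a b
  in β′ , cong₂ _∷_ (cong₂ _∷_ (sym q) e₁)
            (trans p (factor-cong (suc a) l λ i a<i _ → cong (_∷ w i) (r i a<i)))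

-- Mirror equivalence of ω-words

Eventually : (ℕ → Set) → Set
Eventually P = Σ ℕ λ N → ∀ i → N ≤ i → P i

-- Nothing is asked before the first cuts, in keeping with equality modulo finite sets. The pairs
-- `a < b` and `c < d` are independent, so in each word all nonempty unions of consecutive blocks
-- share one class.
record Mirror (k : ℕ) (w w′ : ωWord n) : Set where
  field
    cut cut′ : ℕ → ℕ
    mono     : StrictMono cut
    mono′    : StrictMono cut′
    similar  : ∀ {a b c d} → a < b → c < d →
               reverse (block w (cut a) (cut b)) ≋[ k ] block w′ (cut′ c) (cut′ d)

Mirror-sym : {w w′ : ωWord n} → Mirror k w w′ → Mirror k w′ w
Mirror-sym {k = k} {w = w} {w′} M = record
  { cut = cut′ ; cut′ = cut ; mono = mono′ ; mono′ = mono
  ; similar = λ {a} {b} {c} {d} a<b c<d → subst (reverse (block w′ (cut′ a) (cut′ b)) ≋[ k ]_)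
      (reverse-involutive (block w (cut c) (cut d))) (≋-reverse k (swap (similar c<d a<b))) }
  where open Mirror M

Mirror-pred : {w w′ : ωWord n} → Mirror (suc k) w w′ → Mirror k w w′
Mirror-pred {k = k} M = record
  { cut = cut ; cut′ = cut′ ; mono = mono ; mono′ = mono′
  ; similar = λ a<b c<d → ≋-pred k (similar a<b c<d) }
  where open Mirror M

Mirror-+ˡ : ∀ l {w w′ : ωWord n} → Mirror (l + k) w w′ → Mirror k w w′
Mirror-+ˡ zero    M = M
Mirror-+ˡ (suc l) M = Mirror-+ˡ l (Mirror-pred M)

Mirror-+ʳ : ∀ l {w w′ : ωWord n} → Mirror (k + l) w w′ → Mirror k w w′
Mirror-+ʳ {k = k} l {w} {w′} M = Mirror-+ˡ l (subst (λ j → Mirror j w w′) (+-comm k l) M)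

Mirror-map : (g : Vec Bool m → Vec Bool n) {w w′ : ωWord m} → Mirror k w w′ → Mirror k (g ∘ w) (g ∘ w′)
Mirror-map {k = k} g {w} {w′} M = record
  { cut = cut ; cut′ = cut′ ; mono = mono ; mono′ = mono′
  ; similar = λ {a} {b} {c} {d} a<b c<d → subst₂ (_≋[ k ]_)
      (trans (reverse-map g (block w (cut a) (cut b))) (cong reverse (sym (block-map g w (cut a) (cut b)))))
      (sym (block-map g w′ (cut′ c) (cut′ d))) (≋-map k g (similar a<b c<d)) }
  where open Mirror M

-- Since `a ≤ cut a`, dropping the first `N` cuts leaves only blocks on which the words agree.
Mirror-cong : {w x w′ x′ : ωWord n} → Eventually (λ i → w i ≡ x i) → Eventually (λ i → w′ i ≡ x′ i) →
              Mirror k w w′ → Mirror k x x′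
Mirror-cong {k = k} (N , e) (N′ , e′) M = record
  { cut = cut ∘ (N +_) ; cut′ = cut′ ∘ (N′ +_)
  ; mono = mono ∘ +-monoʳ-< N ; mono′ = mono′ ∘ +-monoʳ-< N′
  ; similar = λ {a} {b} {c} {d} a<b c<d → subst₂ (_≋[ k ]_)
      (cong reverse (block-cong (<⇒≤ (mono (+-monoʳ-< N a<b)))
        λ i a≤i _ → e i (≤-trans (≤-trans (m≤m+n N a) (n≤h[n] mono (N + a))) a≤i)))
      (block-cong (<⇒≤ (mono′ (+-monoʳ-< N′ c<d)))
        λ i c≤i _ → e′ i (≤-trans (≤-trans (m≤m+n N′ c) (n≤h[n] mono′ (N′ + c))) c≤i))
      (similar (+-monoʳ-< N a<b) (+-monoʳ-< N′ c<d)) }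
  where open Mirror M

-- A pair of neighbours of `w′` beyond `cut′ 0` also occurs, in reversed order, in `w` as far out as
-- desired.
Mirror-local : (P : Vec Bool n → Vec Bool n → Set) {w w′ : ωWord n} → Mirror 0 w w′ →
               Eventually (λ i → P (w i) (w (suc i))) → Eventually (λ i → P (w′ (suc i)) (w′ i))
Mirror-local P {w} {w′} M (N , p) = cut′ 0 , holds
  where
  open Mirror M
  holds : ∀ i → cut′ 0 ≤ i → P (w′ (suc i)) (w′ i)
  holds i 0≤i =
    -- As `2 + i ≤ cut′ (2 + i)`, this union of blocks contains both `i` and `suc i`; block `N` of
    -- `w` starts no earlier than `N`.
    let r = adjacent (proj₂ (similar {N} {suc N} {0} {2 + i} (n<1+n N) z<s))
              (Adjacent-block w′ 0≤i (n≤h[n] mono′ (2 + i)))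
        s = subst (Adjacent _ _) (reverse-involutive (block w (cut N) (cut (suc N)))) (Adjacent-reverse r)
        j , N≤j , e , f = Adjacent-factor⁻ w (cut N) _ s
    in subst₂ P e f (p j (≤-trans (n≤h[n] mono N) N≤j))

interval-unique : {h : ℕ → ℕ} → StrictMono h → ∀ {i c d} →
                  h c ≤ i → i < h (suc c) → h d ≤ i → i < h (suc d) → c ≡ d
interval-unique mono {i} {c} {d} p q r s with <-cmp c d
... | tri< c<d _ _ = contradiction (<-≤-trans q (≤-trans (strictMono⇒mono mono c<d) r)) (<-irrefl refl)
... | tri≈ _ c≡d _ = c≡d
... | tri> _ _ d<c = contradiction (<-≤-trans s (≤-trans (strictMono⇒mono mono d<c) p)) (<-irrefl refl)

module _ (em : ExcludedMiddle 0ℓ) where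

  glue : {h : ℕ → ℕ} → StrictMono h → (β : ℕ → Pω) →
         ∃[ B ] ∀ c i → h c ≤ i → i < h (suc c) → β c i ≡ B i
  glue {h} mono β = (λ i → pick i em) , λ c i p q → pick-correct i em c p q
    where
    Located : ℕ → Set
    Located i = ∃[ c ] h c ≤ i × i < h (suc c)

    pick : ∀ i → Dec (Located i) → Bool
    pick i (yes (c , _)) = β c i
    -- Only positions before `h 0` reach this default, and they lie in no block.
    pick i (no _)        = false

    pick-correct : ∀ i (l : Dec (Located i)) c → h c ≤ i → i < h (suc c) → β c i ≡ pick i l
    pick-correct i (yes (d , r , s)) c p q = cong (λ c → β c i) (interval-unique mono p q r s)
    pick-correct i (no ¬l)           c p q = contradiction (c , p , q) ¬l

  -- The back-and-forth step, at the price of one rank. Only the cutting of `w` is coarsened: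
  -- `similar` compares arbitrary unions, so a coarse block of `w` may face each single block of
  -- `w′`.
  Mirror-extend : {w w′ : ωWord n} → Mirror (suc k) w w′ → (B : Pω) →
                  ∃[ B′ ] Mirror k (B ⊹ w) (B′ ⊹ w′)
  Mirror-extend {n} {k} {w} {w′} M B = B′ , record
    { cut = cut ∘ h ; cut′ = cut′ ; mono = mono ∘ h-mono ; mono′ = mono′
    ; similar = λ a<b c<d → ≋-trans k (≋-reverse k (same a<b z<s)) (tile c<d) }
    where
    open Mirror M
    x : ωWord (suc n)
    x = B ⊹ w

    homogeneous = ramsey-~ em (finiteIndex-≋ em k) (λ a b → block x (cut a) (cut b))
    h = proj₁ homogeneous

    h-mono : StrictMono h
    h-mono = proj₁ (proj₂ homogeneous)

    same : ∀ {a b c d} → a < b → c < d →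
           block x (cut (h a)) (cut (h b)) ≋[ k ] block x (cut (h c)) (cut (h d))
    same = proj₂ (proj₂ homogeneous)

    e : Word (suc n)
    e = block x (cut (h 0)) (cut (h 1))

    -- The coarse blocks from 0 to 1, from 1 to 2 and from 0 to 2 are all equivalent, and the third
    -- is the concatenation of the first two.
    idempotent : e ++ e ≋[ k ] e
    idempotent = ≋-trans k (≋-++ k (≋-refl k) (same z<s (n<1+n 1)))
      (subst (_≋[ k ] e) (block-++ x (<⇒≤ (mono (h-mono z<s))) (<⇒≤ (mono (h-mono (n<1+n 1)))))
        (same {0} {2} z<s z<s))

    -- The move played is `reverse e`, a marking of the reversed coarse block of `w`.
    answer : ∀ c → ∃[ y ] map tail y ≡ block w′ (cut′ c) (cut′ (suc c)) × reverse e ≋[ k ] y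
    answer c = proj₁ (similar (h-mono {0} {1} z<s) (n<1+n c)) (reverse e)
      (trans (reverse-map tail e) (cong reverse (sym (block-map tail x (cut (h 0)) (cut (h 1))))))

    bits : ∀ c → ∃[ β ] proj₁ (answer c) ≡ block (β ⊹ w′) (cut′ c) (cut′ (suc c))
    bits c = factor-lift w′ (cut′ c) _ (proj₁ (answer c)) (proj₁ (proj₂ (answer c)))

    glued = glue mono′ (proj₁ ∘ bits)
    B′ = proj₁ glued

    tile-one : ∀ c → reverse e ≋[ k ] block (B′ ⊹ w′) (cut′ c) (cut′ (suc c))
    tile-one c = subst (reverse e ≋[ k ]_)
      (trans (proj₂ (bits c)) (block-cong (<⇒≤ (mono′ (n<1+n c)))
        λ i p q → cong (_∷ w′ i) (proj₂ glued c i p q)))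
      (proj₂ (proj₂ (answer c)))

    tile : ∀ {c d} → c < d → reverse e ≋[ k ] block (B′ ⊹ w′) (cut′ c) (cut′ d)
    tile {c} {suc d} (s≤s c≤d) with m≤n⇒m<n∨m≡n c≤d
    ... | inj₂ refl = tile-one c
    ... | inj₁ c<d = subst (reverse e ≋[ k ]_)
      (sym (block-++ (B′ ⊹ w′) (<⇒≤ (mono′ c<d)) (<⇒≤ (mono′ (n<1+n d)))))
      -- Reversing the idempotence of `e` makes `reverse e` idempotent too, so it absorbs one more
      -- tile.
      (≋-trans k (subst (reverse e ≋[ k ]_) (reverse-++ e e) (≋-reverse k (swap idempotent)))
        (≋-++ k (tile c<d) (tile-one d)))

  -- Over a one-letter alphabet a word equals its reversal, so homogeneous cuts from Ramsey's
  -- theorem serve for both sides.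
  Mirror-unary : ∀ k → Mirror {0} k (λ _ → []) (λ _ → [])
  Mirror-unary k =
    let h , h-mono , same = ramsey-~ em (finiteIndex-≋ em k) (block (λ _ → []))
    in record
      { cut = h ; cut′ = h ; mono = h-mono ; mono′ = h-mono
      ; similar = λ {a} {b} a<b c<d →
          ≋-trans k (≡⇒≋ k (unary (length-reverse (block _ (h a) (h b))))) (same a<b c<d) }
    where
    unary : {u v : Word 0} → length u ≡ length v → u ≡ v
    unary {[]}     {[]}     e = refl
    unary {[] ∷ u} {[] ∷ v} e = cong ([] ∷_) (unary (cong pred e))

-- Terms and formulas

-- The rank that leaves k moves after adjoining the value of the term: each shift
-- is played as a move, whose value is then checked on adjacent letters.
cost : Term n → ℕ → ℕ
cost (var i)  k = k
cost 𝟎        k = k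
cost 𝟏        k = k
cost (s ⊔ₜ t) k = cost s (cost t k)
cost (s ⊓ₜ t) k = cost s (cost t k)
cost (s ∖ₜ t) k = cost s (cost t k)
cost (fₜ t)   k = cost t (suc k)
cost (f⁻¹ₜ t) k = cost t (suc k)

-- Sums serve as upper bounds for the ranks of both subformulas; `Mirror-+ˡ` and `Mirror-+ʳ` descend
-- to either summand.
rank : Formula n → ℕ
rank (s ≐ t)  = cost s (cost t 0)
rank (s ≼ t)  = cost s (cost t 0)
rank ⊥ᶠ       = 0
rank (¬ᶠ φ)   = rank φ
rank (φ ∧ᶠ ψ) = rank φ + rank ψ
rank (φ ∨ᶠ ψ) = rank φ + rank ψ
rank (φ ⇒ᶠ ψ) = rank φ + rank ψ
rank (∀ᶠ φ)   = suc (rank φ)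
rank (∃ᶠ φ)   = suc (rank φ)

-- true stands for σ and false for σ⁻¹.  Only the two automorphisms depend on
-- the orientation, so that the other operations compute for a variable one.
dynamics : Bool → DynStructure
dynamics b = record PωFin-σ
  { autₛ    = if b then shift else unshift
  ; autInvₛ = if b then unshift else shift }

word : Vec Pω n → ωWord n
word ρ i = Vec.map (λ A → A i) ρ

-- Values of subterms are adjoined at the front of the letters; `g` tracks where the parameters have
-- moved.
Reads : Vec Pω n → ωWord m → (Fin n → Fin m) → Set
Reads ρ w g = ∀ i p → lookup ρ i p ≡ lookup (w p) (g i)

everywhere : {P : ℕ → Set} → (∀ i → P i) → Eventually P
everywhere p = 0 , λ i _ → p i

module _ (em : ExcludedMiddle 0ℓ) where

  -- `shift A` is played as a move. Its bit at `suc i` is the bit of `A` at `i`; mirrored, this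
  -- local rule says that the answer at `i` is `A′` at `suc i`, eventually. So the answer is
  -- `unshift A′` modulo a finite set.
  shift-mirror : ∀ {A A′} {w w′ : ωWord n} → Mirror (suc k) (A ⊹ w) (A′ ⊹ w′) →
                 Mirror k (shift A ⊹ w) (unshift A′ ⊹ w′)
  shift-mirror {k = k} {A} {A′} {w} {w′} M =
    let B′ , M′ = Mirror-extend em M (shift A)
        N , e = Mirror-local (λ { (b ∷ a ∷ _) (b′ ∷ a′ ∷ _) → b′ ≡ a }) (Mirror-+ʳ {k = 0} k M′)
                  (everywhere λ i → refl)
    in Mirror-cong (everywhere λ i → refl) (N , λ i N≤i → cong (_∷ w′ i) (e i N≤i))
         (Mirror-map (λ { (b ∷ a ∷ v) → b ∷ v }) M′)

  unshift-mirror : ∀ {A A′} {w w′ : ωWord n} → Mirror (suc k) (A ⊹ w) (A′ ⊹ w′) →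
                   Mirror k (unshift A ⊹ w) (shift A′ ⊹ w′)
  unshift-mirror M = Mirror-sym (shift-mirror (Mirror-sym M))

  mutual
    term-mirror : ∀ b (t : Term n) {w w′ : ωWord m} {ρ ρ′ g} → Reads ρ w g → Reads ρ′ w′ g →
                  Mirror (cost t k) w w′ →
                  Mirror k (evalT (dynamics b) ρ t ⊹ w) (evalT (dynamics (not b)) ρ′ t ⊹ w′)
    term-mirror b (var j) {w} {w′} {g = g} r r′ M =
      Mirror-cong (everywhere λ i → cong (_∷ w i) (sym (r j i)))
        (everywhere λ i → cong (_∷ w′ i) (sym (r′ j i)))
        (Mirror-map (λ v → lookup v (g j) ∷ v) M)
    term-mirror b     𝟎        r r′ M = Mirror-map (false ∷_) M
    term-mirror b     𝟏        r r′ M = Mirror-map (true ∷_) M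
    term-mirror b     (s ⊔ₜ t) r r′ M = binary-mirror b s t r r′ _∨_ M
    term-mirror b     (s ⊓ₜ t) r r′ M = binary-mirror b s t r r′ _∧_ M
    term-mirror b     (s ∖ₜ t) r r′ M = binary-mirror b s t r r′ (λ x y → x ∧ not y) M
    term-mirror true  (fₜ t)   r r′ M = shift-mirror (term-mirror true t r r′ M)
    term-mirror false (fₜ t)   r r′ M = unshift-mirror (term-mirror false t r r′ M)
    term-mirror true  (f⁻¹ₜ t) r r′ M = unshift-mirror (term-mirror true t r r′ M)
    term-mirror false (f⁻¹ₜ t) r r′ M = shift-mirror (term-mirror false t r r′ M)

    pair-mirror : ∀ b (s t : Term n) {w w′ : ωWord m} {ρ ρ′ g} → Reads ρ w g → Reads ρ′ w′ g →
      Mirror (cost s (cost t k)) w w′ →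
      Mirror k (evalT (dynamics b) ρ t ⊹ evalT (dynamics b) ρ s ⊹ w)
               (evalT (dynamics (not b)) ρ′ t ⊹ evalT (dynamics (not b)) ρ′ s ⊹ w′)
    pair-mirror b s t {ρ = ρ} {ρ′} {g} r r′ M =
      -- The value of `s` now heads every letter, hence `suc ∘ g`.
      term-mirror b t {ρ = ρ} {ρ′} {suc ∘ g} r r′ (term-mirror b s r r′ M)

    binary-mirror : ∀ b (s t : Term n) {w w′ : ωWord m} {ρ ρ′ g} → Reads ρ w g → Reads ρ′ w′ g →
      (op : Bool → Bool → Bool) → Mirror (cost s (cost t k)) w w′ →
      Mirror k ((λ i → op (evalT (dynamics b) ρ s i) (evalT (dynamics b) ρ t i)) ⊹ w)
               ((λ i → op (evalT (dynamics (not b)) ρ′ s i) (evalT (dynamics (not b)) ρ′ t i)) ⊹ w′)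
    binary-mirror b s t r r′ op M =
      Mirror-map (λ { (y ∷ x ∷ v) → op x y ∷ v }) (pair-mirror b s t r r′ M)

  reads-word : (ρ : Vec Pω n) → Reads ρ (word ρ) id
  reads-word ρ i p = sym (lookup-map i (λ A → A p) ρ)

  atom-mirror : ∀ b (s t : Term n) (P : Bool → Bool → Set) {ρ ρ′ : Vec Pω n} →
    Mirror (cost s (cost t 0)) (word ρ) (word ρ′) →
    Eventually (λ i → P (evalT (dynamics b) ρ s i) (evalT (dynamics b) ρ t i)) →
    Eventually (λ i → P (evalT (dynamics (not b)) ρ′ s i) (evalT (dynamics (not b)) ρ′ t i))
  atom-mirror b s t P {ρ} {ρ′} M (N , p) =
    let N′ , q = Mirror-local (λ { (y ∷ x ∷ _) _ → P x y })
                   (pair-mirror b s t (reads-word ρ) (reads-word ρ′) M) (N , p)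
    -- The mirrored property speaks of the letter at `suc i`, so the bound moves up by one.
    in suc N′ , λ { (suc i) (s≤s N′≤i) → q i N′≤i }

  sat-mirror : ∀ b (φ : Formula n) {ρ ρ′} → Mirror (rank φ) (word ρ) (word ρ′) →
               Sat (dynamics b) ρ φ → Sat (dynamics (not b)) ρ′ φ
  -- Negations and premises need the converse, which is `sat-mirror` for the other orientation.
  -- Splitting on `b` lets `not (not b)` compute.
  sat-mirror⁻ : ∀ b (φ : Formula n) {ρ ρ′} → Mirror (rank φ) (word ρ) (word ρ′) →
                Sat (dynamics (not b)) ρ′ φ → Sat (dynamics b) ρ φ
  sat-mirror⁻ true  φ M = sat-mirror false φ (Mirror-sym M)
  sat-mirror⁻ false φ M = sat-mirror true  φ (Mirror-sym M)
  sat-mirror b (s ≐ t)  M p        = atom-mirror b s t _≡_ M p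
  sat-mirror b (s ≼ t)  M p        = atom-mirror b s t (λ x y → x ≡ true → y ≡ true) M p
  sat-mirror b (¬ᶠ φ)   M p q      = p (sat-mirror⁻ b φ M q)
  sat-mirror b (φ ∧ᶠ ψ) M (p , q)  =
    sat-mirror b φ (Mirror-+ʳ (rank ψ) M) p , sat-mirror b ψ (Mirror-+ˡ (rank φ) M) q
  sat-mirror b (φ ∨ᶠ ψ) M (inj₁ p) = inj₁ (sat-mirror b φ (Mirror-+ʳ (rank ψ) M) p)
  sat-mirror b (φ ∨ᶠ ψ) M (inj₂ q) = inj₂ (sat-mirror b ψ (Mirror-+ˡ (rank φ) M) q)
  sat-mirror b (φ ⇒ᶠ ψ) M p q      =
    sat-mirror b ψ (Mirror-+ˡ (rank φ) M) (p (sat-mirror⁻ b φ (Mirror-+ʳ (rank ψ) M) q))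
  sat-mirror b (∀ᶠ φ)   M p A′     =
    -- The given set lives in the second structure, so the first one answers.
    let A , M′ = Mirror-extend em (Mirror-sym M) A′ in sat-mirror b φ (Mirror-sym M′) (p A)
  sat-mirror b (∃ᶠ φ)   M (A , p)  =
    let A′ , M′ = Mirror-extend em M A in A′ , sat-mirror b φ M′ p

theorem12p1 : ExcludedMiddle 0ℓ → ElemEquiv PωFin-σ PωFin-σ⁻¹
-- `dynamics true` and `dynamics false` compute to the two structures, and a sentence has no
-- parameters, so both words start over the single letter `[]`.
theorem12p1 em φ = mk⇔ (sat-mirror em true φ M) (sat-mirror em false φ M)
  where
  M : Mirror (rank φ) (word []) (word [])
  M = Mirror-unary em (rank φ)
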